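{- Let $\lambda_a,\lambda_b\in\{1,2\}$ and let $u,t,v,w$ be integers such that $(u,t)$ satisfies $S_{\lambda_a,\lambda_b}$ and $u\cdot(vw)=t^3+t^{\lambda_a}+1$ (i.e. $u,t,vw$ are, in that order, three consecutive terms of $\langle u,t\rangle_{S_{\lambda_a,\lambda_b}}=\langle t,vw\rangle_{S_{3-\lambda_b,\lambda_a}}$). Then $(v,t)$ satisfies $S_{\lambda_a,\lambda_b}$ (i.e. $v,t,uw$ are, in that order, three consecutive terms of $\langle v,t\rangle_{S_{\lambda_a,\lambda_b}}=\langle t,uw\rangle_{S_{3-\lambda_b,\lambda_a}}$) if and only if $$t\mid (u-v)(u^2+uv+v^2+1)\quad\text{when }\lambda_b=1,$$ $$t\mid (u-v)\big((uw)^2+(uw)(vw)+(vw)^2+1\big)\quad\text{when }\lambda_b=2.$$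
   Context: For $\lambda_a,\lambda_b\in\{1,2\}$, a pair of integers $(x,y)$ satisfies the system $S_{\lambda_a,\lambda_b}$ if $x\mid y^3+y^{\lambda_a}+1$ and $y\mid x^3+x^{\lambda_b}+1$. For such a pair, $\langle x,y\rangle_{S_{\lambda_a,\lambda_b}}$ denotes the bi-infinite integer sequence $(u_n)$ with $u_0=x$, $u_1=y$ and $u_{n-1}u_{n+1}=u_n^3+u_n^{e_n}+1$ for all $n$, where $e_n$ has period 4 with $(e_0,e_1,e_2,e_3)=(\lambda_b,\lambda_a,3-\lambda_b,3-\lambda_a)$; sequences are identified up to shift and reversal of indices. "$u,t,s$, in that order, are three consecutive terms of $\langle u,t\rangle_{S_{\lambda_a,\lambda_b}}$" means $(u,t)$ satisfies $S_{\lambda_a,\lambda_b}$ and $us=t^3+t^{\lambda_a}+1$; then $(t,s)$ satisfies $S_{3-\lambda_b,\lambda_a}$. -}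

module Defs where

open import Data.Nat using (ℕ)
open import Data.Integer using (ℤ; 1ℤ; _+_; _*_; _^_)
open import Data.Integer.Divisibility.Signed using (_∣_)
open import Data.Product using (_×_)
open import Data.Sum using (_⊎_)
open import Relation.Binary.PropositionalEquality using (_≡_)

OneOrTwo : ℕ → Set
OneOrTwo e = (e ≡ 1) ⊎ (e ≡ 2)

cubic : ℕ → ℤ → ℤ
cubic e x = x ^ 3 + x ^ e + 1ℤ

-- The system S_{λa,λb}; the exponent λa belongs to the second entry of
-- the pair and λb to the first.
Satisfies : (λa λb : ℕ) → ℤ → ℤ → Set
Satisfies λa λb x y = (x ∣ cubic λa y) × (y ∣ cubic λb x)

-- u, t, s are, in that order, three consecutive terms of the bi-infinite
-- sequence ⟨u,t⟩ attached to S_{λa,λb}: there u and t sit at indices 0 and 1,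
-- where the recurrence u₀ u₂ = u₁³ + u₁^(e₁) + 1 has e₁ = λa.
ThreeConsecutive : (λa λb : ℕ) → ℤ → ℤ → ℤ → Set
ThreeConsecutive λa λb u t s = Satisfies λa λb u t × (u * s ≡ cubic λa t)

{-# OPTIONS --safe #-}
-- Since u v w = cubic λa t ≡ 1 (mod t), the pairs (u , v w) and (v , u w) are
-- inverse to each other modulo t. For λb = 1 the stated product is
-- cubic 1 u - cubic 1 v. For λb = 2, passing to inverses exchanges cubic 2 and
-- cubic 1 up to a unit, so the condition becomes
-- t ∣ cubic 1 (u w) - cubic 1 (v w), in which w is a unit modulo t.
module Submission where

open import Data.Nat using (ℕ)
open import Data.Integer using (ℤ; 1ℤ; _+_; _-_; _*_; _^_)
open import Data.Integer.Divisibility.Signed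
  using (_∣_; divides; ∣m∣n⇒∣m+n; ∣m∣n⇒∣m-n; ∣n⇒∣m*n; ∣m⇒∣m*n)
open import Data.Integer.Properties using (*-assoc; *-comm)
open import Data.Integer.Solver using (module +-*-Solver)
open import Data.Product using (_×_; _,_; proj₁; proj₂)
open import Data.Sum using (inj₁; inj₂)
open import Function.Bundles using (_⇔_; mk⇔; Equivalence)
open import Function.Construct.Composition using (_⇔-∘_)
open import Relation.Binary.PropositionalEquality using (_≡_; refl; sym; trans; subst)
open import Defs
open +-*-Solver

∣-cong-mod : ∀ {d m n} → d ∣ m - n → d ∣ m ⇔ d ∣ n
∣-cong-mod {d} {m} {n} d∣m-n = mk⇔
  (λ d∣m → subst (d ∣_) (m-[m-n]≡n m n) (∣m∣n⇒∣m-n d∣m d∣m-n))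
  (λ d∣n → subst (d ∣_) (m-n+n≡m m n) (∣m∣n⇒∣m+n d∣m-n d∣n))
  where
  m-[m-n]≡n : ∀ m n → m - (m - n) ≡ n
  m-[m-n]≡n = solve 2 (λ m n → m :- (m :- n) := n) refl

  m-n+n≡m : ∀ m n → m - n + n ≡ m
  m-n+n≡m = solve 2 (λ m n → m :- n :+ n := m) refl

∣m⇒∣n⇔∣m-n : ∀ {d m n} → d ∣ m → d ∣ n ⇔ d ∣ m - n
∣m⇒∣n⇔∣m-n d∣m = mk⇔ (∣m∣n⇒∣m-n d∣m)
  (λ d∣m-n → Equivalence.to (∣-cong-mod d∣m-n) d∣m)

∣n⇒∣m⇔∣m-n : ∀ {d m n} → d ∣ n → d ∣ m ⇔ d ∣ m - n
∣n⇒∣m⇔∣m-n d∣n = mk⇔ (λ d∣m → ∣m∣n⇒∣m-n d∣m d∣n)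
  (λ d∣m-n → Equivalence.from (∣-cong-mod d∣m-n) d∣n)

-- Since `x` inverts `y` modulo `d`, multiplying `y * z` by `x` gives back `z` modulo `d`.
unit-⇔ : ∀ {d} x y z → d ∣ x * y - 1ℤ → d ∣ y * z ⇔ d ∣ z
unit-⇔ {d} x y z d∣xy-1 = mk⇔
  (λ d∣yz → Equivalence.to
    (∣-cong-mod (subst (d ∣_) (eq x y z) (∣m⇒∣m*n z d∣xy-1))) (∣n⇒∣m*n x d∣yz))
  (∣n⇒∣m*n y)
  where
  eq : ∀ x y z → (x * y - 1ℤ) * z ≡ x * (y * z) - z
  eq = solve 3 (λ x y z → (x :* y :- con 1ℤ) :* z := x :* (y :* z) :- z) refl

cubic-difference : ∀ x y → cubic 1 x - cubic 1 y ≡ (x - y) * (x ^ 2 + x * y + y ^ 2 + 1ℤ)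
cubic-difference = solve 2 (λ x y →
  (x :^ 3 :+ x :^ 1 :+ con 1ℤ) :- (y :^ 3 :+ y :^ 1 :+ con 1ℤ)
    := (x :- y) :* (x :^ 2 :+ x :* y :+ y :^ 2 :+ con 1ℤ)) refl

-- Multiplying `cubic 2 x` by `y ^ 3` and replacing each `x * y` by 1 leaves 1 + y + y³; multiplying
-- `cubic 1 y` by `x ^ 3` leaves 1 + x² + x³ in the same way.
cubic-inverse : ∀ {t} x y → t ∣ x * y - 1ℤ → t ∣ cubic 2 x ⇔ t ∣ cubic 1 y
cubic-inverse {t} x y t∣xy-1 = mk⇔
  (λ h → Equivalence.to
    (∣-cong-mod (subst (t ∣_) (eq₁ x y) (∣m⇒∣m*n _ t∣xy-1))) (∣n⇒∣m*n (y ^ 3) h))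
  (λ h → Equivalence.to
    (∣-cong-mod (subst (t ∣_) (eq₂ x y) (∣m⇒∣m*n _ t∣xy-1))) (∣n⇒∣m*n (x ^ 3) h))
  where
  -- With a = xy, the difference is (a³ - 1) + y(a² - 1); the second factor on the left is what
  -- remains after taking out a - 1. In `eq₂` the difference is (a³ - 1) + x²(a - 1).
  eq₁ : ∀ x y → (x * y - 1ℤ) * ((x * y) ^ 2 + x * y + 1ℤ + y * (x * y + 1ℤ))
              ≡ y ^ 3 * cubic 2 x - cubic 1 y
  eq₁ = solve 2 (λ x y →
    (x :* y :- con 1ℤ) :* ((x :* y) :^ 2 :+ x :* y :+ con 1ℤ :+ y :* (x :* y :+ con 1ℤ))
      := y :^ 3 :* (x :^ 3 :+ x :^ 2 :+ con 1ℤ) :- (y :^ 3 :+ y :^ 1 :+ con 1ℤ)) refl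

  eq₂ : ∀ x y → (x * y - 1ℤ) * ((x * y) ^ 2 + x * y + 1ℤ + x ^ 2)
              ≡ x ^ 3 * cubic 1 y - cubic 2 x
  eq₂ = solve 2 (λ x y →
    (x :* y :- con 1ℤ) :* ((x :* y) :^ 2 :+ x :* y :+ con 1ℤ :+ x :^ 2)
      := x :^ 3 :* (y :^ 3 :+ y :^ 1 :+ con 1ℤ) :- (x :^ 3 :+ x :^ 2 :+ con 1ℤ)) refl

-- Both exponents are positive, so only the constant term survives modulo `t`. Applied to
-- `cubic λa t`, this makes `u`, `v` and `w` units modulo `t`.
∣cubic-1 : ∀ {e} → OneOrTwo e → ∀ t → t ∣ cubic e t - 1ℤ
∣cubic-1 (inj₁ refl) t = divides (t ^ 2 + 1ℤ)
  (solve 1 (λ t → (t :^ 3 :+ t :^ 1 :+ con 1ℤ) :- con 1ℤ := (t :^ 2 :+ con 1ℤ) :* t) refl t)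
∣cubic-1 (inj₂ refl) t = divides (t ^ 2 + t)
  (solve 1 (λ t → (t :^ 3 :+ t :^ 2 :+ con 1ℤ) :- con 1ℤ := (t :^ 2 :+ t) :* t) refl t)

theorem11 : ∀ (λa λb : ℕ) → OneOrTwo λa → OneOrTwo λb →
    ∀ (u t v w : ℤ) →
    ThreeConsecutive λa λb u t (v * w) →
    (Satisfies λa λb v t ⇔ ThreeConsecutive λa λb v t (u * w))
    × (λb ≡ 1 →
    Satisfies λa λb v t ⇔
    t ∣ (u - v) * (u ^ 2 + u * v + v ^ 2 + 1ℤ))
    × (λb ≡ 2 →
    Satisfies λa λb v t ⇔
    t ∣ (u - v) * ((u * w) ^ 2 + (u * w) * (v * w) + (v * w) ^ 2 + 1ℤ))
theorem11 λa λb λa∈ _ u t v w ((_ , t∣cubic-u) , u*vw≡cubic) =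
  mk⇔ (_, v*uw≡cubic) proj₁ , case-1 , case-2
  where
  swap : ∀ u v w → v * (u * w) ≡ u * (v * w)
  swap = solve 3 (λ u v w → v :* (u :* w) := u :* (v :* w)) refl

  v*uw≡cubic : v * (u * w) ≡ cubic λa t
  v*uw≡cubic = trans (swap u v w) u*vw≡cubic

  satisfies⇔ : Satisfies λa λb v t ⇔ t ∣ cubic λb v
  satisfies⇔ = mk⇔ proj₂
    -- Divisibility by `v` is automatic: the cofactor is `u * w`, because the product of `u`, `v`
    -- and `w` is symmetric in `u` and `v`.
    (divides (u * w) (trans (sym v*uw≡cubic) (*-comm v (u * w))) ,_)

  t∣u*vw-1 : t ∣ u * (v * w) - 1ℤ
  t∣u*vw-1 = subst (λ n → t ∣ n - 1ℤ) (sym u*vw≡cubic) (∣cubic-1 λa∈ t)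

  t∣v*uw-1 : t ∣ v * (u * w) - 1ℤ
  t∣v*uw-1 = subst (λ n → t ∣ n - 1ℤ) (sym v*uw≡cubic) (∣cubic-1 λa∈ t)

  case-1 : λb ≡ 1 → Satisfies λa λb v t ⇔ t ∣ (u - v) * (u ^ 2 + u * v + v ^ 2 + 1ℤ)
  case-1 refl = subst (λ n → Satisfies λa 1 v t ⇔ t ∣ n) (cubic-difference u v)
    (∣m⇒∣n⇔∣m-n t∣cubic-u ⇔-∘ satisfies⇔)

  case-2 : λb ≡ 2 → Satisfies λa λb v t ⇔
    t ∣ (u - v) * ((u * w) ^ 2 + (u * w) * (v * w) + (v * w) ^ 2 + 1ℤ)
  case-2 refl =
    -- The chain runs from right to left: replace `v` by its inverse `u * w`, subtract the value at
    -- `v * w`, which `t` divides because `v * w` is the inverse of `u`, then cancel `w`, whose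
    -- inverse is `u * v`.
    unit-⇔ (u * v) w _ t∣uv*w-1
      ⇔-∘ (subst (λ n → Satisfies λa 2 v t ⇔ t ∣ n) difference
        (∣n⇒∣m⇔∣m-n (Equivalence.to (cubic-inverse u (v * w) t∣u*vw-1) t∣cubic-u)
          ⇔-∘ (cubic-inverse v (u * w) t∣v*uw-1 ⇔-∘ satisfies⇔)))
    where
    t∣uv*w-1 : t ∣ u * v * w - 1ℤ
    t∣uv*w-1 = subst (λ n → t ∣ n - 1ℤ) (sym (*-assoc u v w)) t∣u*vw-1

    factor-w : ∀ u v w z → (u * w - v * w) * z ≡ w * ((u - v) * z)
    factor-w = solve 4 (λ u v w z → (u :* w :- v :* w) :* z := w :* ((u :- v) :* z)) refl

    difference : cubic 1 (u * w) - cubic 1 (v * w)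
      ≡ w * ((u - v) * ((u * w) ^ 2 + (u * w) * (v * w) + (v * w) ^ 2 + 1ℤ))
    difference = trans (cubic-difference (u * w) (v * w)) (factor-w u v w _)
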